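{- For every $M$ with $0\le M<\frac12$, every deterministic semi-online algorithm with migration factor $M$ for scheduling on two hierarchical machines with known optimal makespan (bin stretching) has competitive ratio at least $\frac32$.
   Context: Model (two hierarchical machines with migration, bin stretching). Jobs $1,2,\dots,n$ arrive one by one ($n$ unknown in advance). Job $j$ has a size $p_j>0$ and a grade of service (GoS) $g_j\in\{1,2\}$; a job of GoS $1$ may only be processed on machine $m_1$, a job of GoS $2$ may be processed on $m_1$ or on $m_2$. The load of a machine is the total size of its jobs, the makespan is the maximum load. When job $j$ arrives, the algorithm must assign it, and may migrate previously arrived jobs (respecting GoS) of total size at most $M\cdot p_j$ (migration factor $M$). Bin stretching: the optimal offline makespan of the complete input is known in advance to the algorithm (scaled to $1$). The competitive ratio is the supremum over inputs of (algorithm's makespan)/(optimal makespan). -}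

module Defs where

open import Algebra.Bundles using (CommutativeRing)
import Algebra.Construct.NaturalChoice.Max as Max
import Algebra.Properties.Ring as RingProperties
open import Data.List using (List; []; _∷_; _++_)
open import Data.List.Relation.Unary.All using (All; []; _∷_; tail)
open import Data.Product using (∃; _×_; _,_)
open import Data.Sum using (inj₁; inj₂)
open import Level using (Level; _⊔_; suc)
open import Relation.Binary.Bundles using (TotalOrder)
open import Relation.Binary.Core using (Rel)
import Relation.Binary.Construct.NonStrictToStrict as ToStrict
open import Relation.Binary.Definitions using (DecidableEquality)
open import Relation.Binary.PropositionalEquality using (refl)
open import Relation.Binary.Structures using (IsTotalOrder)
open import Relation.Nullary using (¬_; yes; no)

-- The library has no real numbers, so sizes, loads, the migration factor and
-- ratios are taken in an arbitrary ordered field (ℚ, or classically ℝ).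
record OrderedField (c ℓ₁ ℓ₂ : Level) : Set (suc (c ⊔ ℓ₁ ⊔ ℓ₂)) where
  infix 4 _≤_
  field
    commutativeRing : CommutativeRing c ℓ₁
  open CommutativeRing commutativeRing public
  field
    _≤_          : Rel Carrier ℓ₂
    isTotalOrder : IsTotalOrder _≈_ _≤_
    +-monoˡ-≤    : ∀ z {x y} → x ≤ y → x + z ≤ y + z
    *-nonNeg     : ∀ {x y} → 0# ≤ x → 0# ≤ y → 0# ≤ x * y
    1≉0          : ¬ 1# ≈ 0#
    inv          : ∀ x → ¬ x ≈ 0# → Carrier
    inverseʳ     : ∀ x (x≉0 : ¬ x ≈ 0#) → x * inv x x≉0 ≈ 1#

  totalOrder : TotalOrder c ℓ₁ ℓ₂
  totalOrder = record { isTotalOrder = isTotalOrder }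

  open IsTotalOrder isTotalOrder public
    using (total; antisym; ≤-respˡ-≈; ≤-respʳ-≈)
    renaming (refl to ≤-refl; reflexive to ≤-reflexive; trans to ≤-trans)
  open Max totalOrder public using () renaming (_⊔_ to max)

  infix 4 _<_
  _<_ : Rel Carrier (ℓ₁ ⊔ ℓ₂)
  _<_ = ToStrict._<_ _≈_ _≤_

  0≤1 : 0# ≤ 1#
  0≤1 with total 0# 1#
  ... | inj₁ 0≤1′ = 0≤1′
  ... | inj₂ 1≤0  = ≤-respʳ-≈ [-1]²≈1 (*-nonNeg 0≤-1 0≤-1)
    where
    open RingProperties ring using (-1*x≈-x; -‿involutive)
    0≤-1 : 0# ≤ - 1#
    0≤-1 = ≤-respˡ-≈ (-‿inverseʳ 1#) (≤-respʳ-≈ (+-identityˡ (- 1#)) (+-monoˡ-≤ (- 1#) 1≤0))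
    [-1]²≈1 : - 1# * - 1# ≈ 1#
    [-1]²≈1 = trans (-1*x≈-x (- 1#)) (-‿involutive 1#)

  2# 3# : Carrier
  2# = 1# + 1#
  3# = 2# + 1#

  2≉0 : ¬ 2# ≈ 0#
  2≉0 2≈0 = 1≉0 (antisym 1≤0 0≤1)
    where
    1≤0 : 1# ≤ 0#
    1≤0 = ≤-respʳ-≈ 2≈0 (≤-respˡ-≈ (+-identityˡ 1#) (+-monoˡ-≤ 1# 0≤1))

  ½ 3/2 : Carrier
  ½   = inv 2# 2≉0
  3/2 = 3# * ½

data GoS : Set where
  gos₁ gos₂ : GoS

data Machine : Set where
  m₁ m₂ : Machine

infix 4 _≟_
_≟_ : DecidableEquality Machine
m₁ ≟ m₁ = yes refl
m₁ ≟ m₂ = no λ ()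
m₂ ≟ m₁ = no λ ()
m₂ ≟ m₂ = yes refl

data Eligible : GoS → Machine → Set where
  any-m₁  : ∀ {g} → Eligible g m₁
  gos₂-m₂ : Eligible gos₂ m₂

module BinStretching {c ℓ₁ ℓ₂ : Level} (F : OrderedField c ℓ₁ ℓ₂) where
  open OrderedField F

  record Job : Set (c ⊔ ℓ₁ ⊔ ℓ₂) where
    constructor job
    field
      size   : Carrier
      size>0 : 0# < size
      gos    : GoS
  open Job public

  -- Jobs are listed with the latest arrival first: when j arrives after the
  -- jobs js, the jobs seen so far become j ∷ js.
  Jobs : Set (c ⊔ ℓ₁ ⊔ ℓ₂)
  Jobs = List Job

  Schedule : Jobs → Set (c ⊔ ℓ₁ ⊔ ℓ₂)
  Schedule = All (λ j → ∃ (Eligible (gos j)))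

  load : Machine → {js : Jobs} → Schedule js → Carrier
  load m []                      = 0#
  load m {j ∷ _} ((m′ , _) ∷ σ) with m ≟ m′
  ... | yes _ = size j + load m σ
  ... | no  _ = load m σ

  makespan : {js : Jobs} → Schedule js → Carrier
  makespan σ = max (load m₁ σ) (load m₂ σ)

  IsOptimalMakespan : Jobs → Carrier → Set (c ⊔ ℓ₁ ⊔ ℓ₂)
  IsOptimalMakespan js T =
    (∃ λ (σ : Schedule js) → makespan σ ≈ T) × (∀ (σ : Schedule js) → T ≤ makespan σ)

  migrated : {js : Jobs} → Schedule js → Schedule js → Carrier
  migrated []                      []              = 0#
  migrated {j ∷ _} ((m , _) ∷ σ) ((m′ , _) ∷ σ′) with m ≟ m′
  ... | yes _ = migrated σ σ′
  ... | no  _ = size j + migrated σ σ′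

  -- The complete inputs: those whose optimal makespan is the announced value 1.
  IsInput : Jobs → Set (c ⊔ ℓ₁ ⊔ ℓ₂)
  IsInput js = IsOptimalMakespan js 1#

  -- The job sequences the algorithm may face at some point of time, i.e. the
  -- initial parts of inputs.
  Possible : Jobs → Set (c ⊔ ℓ₁ ⊔ ℓ₂)
  Possible js = ∃ λ (later : Jobs) → IsInput (later ++ js)

  -- A deterministic algorithm with migration factor M.  Its state after the
  -- arrival of js depends on js only.  The migration bound is not required on
  -- sequences that contradict the announced optimum, since these never occur.
  record Algorithm (M : Carrier) : Set (c ⊔ ℓ₁ ⊔ ℓ₂) where
    field
      schedule  : (js : Jobs) → Schedule js
      migration : ∀ j js → Possible (j ∷ js) →
                  migrated (schedule js) (tail (schedule (j ∷ js))) ≤ M * size j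
  open Algorithm public

  -- On an input the optimal makespan is 1, so the ratio of the two makespans
  -- is the makespan of the algorithm.
  RatioBound : {M : Carrier} → Algorithm M → Carrier → Set (c ⊔ ℓ₁ ⊔ ℓ₂)
  RatioBound A r = ∀ js → IsInput js → makespan (schedule A js) ≤ r

  -- The supremum of the ratios is at least R.  It need not exist in F, so this
  -- says that R is below every upper bound of the ratios.
  CompetitiveRatioAtLeast : {M : Carrier} → Algorithm M → Carrier → Set (c ⊔ ℓ₁ ⊔ ℓ₂)
  CompetitiveRatioAtLeast A R = ∀ r → RatioBound A r → R ≤ r

-- All jobs used have size ½ or 1, so for M < ½ no arrival pays for moving any
-- earlier job.  Start with a job of size ½ and GoS 2.  If it is put on m₁, a job
-- of size 1 and GoS 1 follows.  If it is put on m₂, a job of size 1 and GoS 2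
-- follows; when that one goes to m₁, a job of size ½ and GoS 1 is added.  In each
-- case some machine gets load 3/2, while the optimum is 1.

module Submission where

open import Level using (Level)
open import Data.Empty using (⊥-elim)
open import Data.List using ([]; _∷_)
open import Data.List.Relation.Unary.All using (All; []; _∷_; tail)
open import Data.List.Relation.Unary.Any using (Any; here; there)
open import Data.Product using (_,_; proj₁; proj₂)
open import Data.Sum using (inj₁; inj₂)
open import Relation.Binary.Bundles using (TotalOrder)
open import Relation.Binary.PropositionalEquality using (_≡_; refl; cong; cong₂)
open import Relation.Nullary using (¬_; yes; no)
import Algebra.Construct.NaturalChoice.Max as Max
import Relation.Binary.Reasoning.PartialOrder as ≤-Reasoning
open import Defs

module OrderedFieldProperties {c ℓ₁ ℓ₂ : Level} (F : OrderedField c ℓ₁ ℓ₂) where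
  open OrderedField F
  open ≤-Reasoning (TotalOrder.poset totalOrder)

  +-mono-≤ : ∀ {w x y z} → w ≤ x → y ≤ z → w + y ≤ x + z
  +-mono-≤ {w} {x} {y} {z} w≤x y≤z = begin
    w + y ≤⟨ +-monoˡ-≤ y w≤x ⟩
    x + y ≈⟨ +-comm x y ⟩
    y + x ≤⟨ +-monoˡ-≤ x y≤z ⟩
    z + x ≈⟨ +-comm z x ⟩
    x + z ∎

  x≤x+y : ∀ {x y} → 0# ≤ y → x ≤ x + y
  x≤x+y {x} {y} 0≤y = begin
    x      ≈⟨ +-identityʳ x ⟨
    x + 0# ≤⟨ +-mono-≤ ≤-refl 0≤y ⟩
    x + y  ∎

  x≤y+x : ∀ {x y} → 0# ≤ y → x ≤ y + x
  x≤y+x {x} {y} 0≤y = ≤-respʳ-≈ (+-comm x y) (x≤x+y 0≤y)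

  +-nonNeg : ∀ {x y} → 0# ≤ x → 0# ≤ y → 0# ≤ x + y
  +-nonNeg 0≤x 0≤y = ≤-trans 0≤x (x≤x+y 0≤y)

  -- The gap `x * (1# + - y)` is a product of two nonnegative factors.
  x*y≤x : ∀ {x y} → 0# ≤ x → y ≤ 1# → x * y ≤ x
  x*y≤x {x} {y} 0≤x y≤1 = begin
    x * y                    ≤⟨ x≤x+y (*-nonNeg 0≤x 0≤1-y) ⟩
    x * y + x * (1# + - y)   ≈⟨ distribˡ x y (1# + - y) ⟨
    x * (y + (1# + - y))     ≈⟨ *-congˡ (+-congˡ (+-comm 1# (- y))) ⟩
    x * (y + (- y + 1#))     ≈⟨ *-congˡ (+-assoc y (- y) 1#) ⟨
    x * (y + - y + 1#)       ≈⟨ *-congˡ (+-congʳ (-‿inverseʳ y)) ⟩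
    x * (0# + 1#)            ≈⟨ *-congˡ (+-identityˡ 1#) ⟩
    x * 1#                   ≈⟨ *-identityʳ x ⟩
    x                        ∎
    where
    0≤1-y : 0# ≤ 1# + - y
    0≤1-y = ≤-respˡ-≈ (-‿inverseʳ y) (+-monoˡ-≤ (- y) y≤1)

  <⇒≱ : ∀ {x y} → x < y → ¬ y ≤ x
  <⇒≱ (x≤y , x≉y) y≤x = x≉y (antisym x≤y y≤x)

  0<1 : 0# < 1#
  0<1 = 0≤1 , λ 0≈1 → 1≉0 (sym 0≈1)

  2*½≈1 : 2# * ½ ≈ 1#
  2*½≈1 = inverseʳ 2# 2≉0

  ½+½≈1 : ½ + ½ ≈ 1#
  ½+½≈1 = begin-equality
    ½ + ½           ≈⟨ +-cong (*-identityˡ ½) (*-identityˡ ½) ⟨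
    1# * ½ + 1# * ½ ≈⟨ distribʳ ½ 1# 1# ⟨
    2# * ½          ≈⟨ 2*½≈1 ⟩
    1#              ∎

  1+½≈3/2 : 1# + ½ ≈ 3/2
  1+½≈3/2 = begin-equality
    1# + ½          ≈⟨ +-cong 2*½≈1 (*-identityˡ ½) ⟨
    2# * ½ + 1# * ½ ≈⟨ distribʳ ½ 2# 1# ⟨
    3/2             ∎

  -- Doubling `½ ≤ 0#` would give `1# ≤ 0#`; totality of the order then yields `0<½`.
  ½≰0 : ¬ ½ ≤ 0#
  ½≰0 ½≤0 = <⇒≱ 0<1 (begin
    1#      ≈⟨ ½+½≈1 ⟨
    ½ + ½   ≤⟨ +-mono-≤ ½≤0 ½≤0 ⟩
    0# + 0# ≈⟨ +-identityˡ 0# ⟩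
    0#      ∎)

  0<½ : 0# < ½
  0<½ with total 0# ½
  ... | inj₁ 0≤½ = 0≤½ , λ 0≈½ → ½≰0 (≤-reflexive (sym 0≈½))
  ... | inj₂ ½≤0 = ⊥-elim (½≰0 ½≤0)

  ½≤1 : ½ ≤ 1#
  ½≤1 = ≤-respʳ-≈ ½+½≈1 (x≤x+y (proj₁ 0<½))

-- Lets schedules with the same machine choices be identified propositionally.
Eligible-irrelevant : ∀ {g m} (p q : Eligible g m) → p ≡ q
Eligible-irrelevant any-m₁  any-m₁  = refl
Eligible-irrelevant gos₂-m₂ gos₂-m₂ = refl

module LowerBound {c ℓ₁ ℓ₂ : Level} (F : OrderedField c ℓ₁ ℓ₂) where
  open OrderedField F hiding (refl)
  open BinStretching F
  open OrderedFieldProperties F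
  open Max totalOrder using (x≤x⊔y; x≤y⊔x; ⊔-lub)
  open ≤-Reasoning (TotalOrder.poset totalOrder)

  load≤makespan : ∀ m {js} (σ : Schedule js) → load m σ ≤ makespan σ
  load≤makespan m₁ σ = x≤x⊔y (load m₁ σ) (load m₂ σ)
  load≤makespan m₂ σ = x≤y⊔x (load m₁ σ) (load m₂ σ)

  load-nonNeg : ∀ m {js} (σ : Schedule js) → 0# ≤ load m σ
  load-nonNeg m []                      = ≤-refl
  load-nonNeg m {j ∷ _} ((m′ , _) ∷ σ) with m ≟ m′
  ... | yes _ = +-nonNeg (proj₁ (size>0 j)) (load-nonNeg m σ)
  ... | no  _ = load-nonNeg m σ

  load-tail : ∀ m {j js} (σ : Schedule (j ∷ js)) → load m (tail σ) ≤ load m σ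
  load-tail m {j} ((m′ , _) ∷ σ) with m ≟ m′
  ... | yes _ = x≤y+x (proj₁ (size>0 j))
  ... | no  _ = ≤-refl

  -- Whichever machine holds the large job has at least its size as load, and further jobs never
  -- lower a load.
  job≤makespan : ∀ {p js} → Any (λ j → p ≤ size j) js → (σ : Schedule js) → p ≤ makespan σ
  job≤makespan (here p≤j) σ@((m₁ , _) ∷ σ′) =
    ≤-trans p≤j (≤-trans (x≤x+y (load-nonNeg m₁ σ′)) (load≤makespan m₁ σ))
  job≤makespan (here p≤j) σ@((m₂ , _) ∷ σ′) =
    ≤-trans p≤j (≤-trans (x≤x+y (load-nonNeg m₂ σ′)) (load≤makespan m₂ σ))
  job≤makespan (there j∈) σ@(_ ∷ σ′) = ≤-trans (job≤makespan j∈ σ′)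
    (⊔-lub (≤-trans (load-tail m₁ σ) (load≤makespan m₁ σ))
           (≤-trans (load-tail m₂ σ) (load≤makespan m₂ σ)))

  -- A job of size at least 1 forces every makespan up to 1, so one schedule with both loads at most
  -- 1 certifies the optimum.
  isInput : ∀ {js} → Any (λ j → 1# ≤ size j) js →
            (σ : Schedule js) → load m₁ σ ≤ 1# → load m₂ σ ≤ 1# → IsInput js
  isInput big σ l₁≤1 l₂≤1 =
    (σ , antisym (⊔-lub l₁≤1 l₂≤1) (job≤makespan big σ)) , job≤makespan big

  input⇒possible : ∀ {js} → IsInput js → Possible js
  input⇒possible input = [] , input

  migrated-nonNeg : ∀ {js} (σ σ′ : Schedule js) → 0# ≤ migrated σ σ′
  migrated-nonNeg []                      []              = ≤-refl
  migrated-nonNeg {j ∷ _} ((m , _) ∷ σ) ((m′ , _) ∷ σ′) with m ≟ m′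
  ... | yes _ = migrated-nonNeg σ σ′
  ... | no  _ = +-nonNeg (proj₁ (size>0 j)) (migrated-nonNeg σ σ′)

  -- A single moved job already contributes at least `p`. Concluding `≡` allows later matching on
  -- `refl`.
  migrated≱⇒≡ : ∀ {p js} → All (λ j → p ≤ size j) js →
                (σ σ′ : Schedule js) → ¬ p ≤ migrated σ σ′ → σ ≡ σ′
  migrated≱⇒≡ []           []            []              _  = refl
  migrated≱⇒≡ (p≤j ∷ p≤js) ((m , e) ∷ σ) ((m′ , e′) ∷ σ′) p≰ with m ≟ m′
  ... | yes refl = cong₂ _∷_ (cong (m ,_) (Eligible-irrelevant e e′))
                             (migrated≱⇒≡ p≤js σ σ′ p≰)
  ... | no  _    = ⊥-elim (p≰ (≤-trans p≤j (x≤x+y (migrated-nonNeg σ σ′))))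

  -- Moving any earlier job costs at least `½`, while the budget `M * size j` is at most `M`.
  unmigrated : ∀ {M} → 0# ≤ M → M < ½ → (A : Algorithm M) →
               ∀ {j js} → size j ≤ 1# → All (λ i → ½ ≤ size i) js → Possible (j ∷ js) →
               schedule A js ≡ tail (schedule A (j ∷ js))
  unmigrated {M} 0≤M M<½ A {j} {js} j≤1 ½≤js possible =
    migrated≱⇒≡ ½≤js _ _ λ ½≤migrated → <⇒≱ M<½ (begin
      ½                                                     ≤⟨ ½≤migrated ⟩
      migrated (schedule A js) (tail (schedule A (j ∷ js))) ≤⟨ migration A j js possible ⟩
      M * size j                                            ≤⟨ x*y≤x 0≤M j≤1 ⟩
      M                                                     ∎)

  half unit : GoS → Job
  half = job ½ 0<½
  unit = job 1# 0<1

  -- `inputB` is a complete input and also a prefix of `inputC`, so the adversary may stop there or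
  -- go on.
  firstJob inputA inputB inputC : Jobs
  firstJob = half gos₂ ∷ []
  inputA   = unit gos₁ ∷ firstJob
  inputB   = unit gos₂ ∷ firstJob
  inputC   = half gos₁ ∷ inputB

  1+0≤1 : 1# + 0# ≤ 1#
  1+0≤1 = ≤-reflexive (+-identityʳ 1#)

  ½+0≤1 : ½ + 0# ≤ 1#
  ½+0≤1 = ≤-respˡ-≈ (sym (+-identityʳ ½)) ½≤1

  ½+½+0≤1 : ½ + (½ + 0#) ≤ 1#
  ½+½+0≤1 = ≤-reflexive (trans (+-congˡ (+-identityʳ ½)) ½+½≈1)

  isInputA : IsInput inputA
  isInputA = isInput (here ≤-refl) ((m₁ , any-m₁) ∷ (m₂ , gos₂-m₂) ∷ []) 1+0≤1 ½+0≤1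

  isInputB : IsInput inputB
  isInputB = isInput (here ≤-refl) ((m₂ , gos₂-m₂) ∷ (m₁ , any-m₁) ∷ []) ½+0≤1 1+0≤1

  isInputC : IsInput inputC
  isInputC = isInput (there (here ≤-refl))
    -- The two halves fill `m₁` and the unit job fills `m₂`.
    ((m₁ , any-m₁) ∷ (m₂ , gos₂-m₂) ∷ (m₁ , any-m₁) ∷ []) ½+½+0≤1 1+0≤1

  3/2≤1+½+0 : 3/2 ≤ 1# + (½ + 0#)
  3/2≤1+½+0 = ≤-reflexive (sym (trans (+-congˡ (+-identityʳ ½)) 1+½≈3/2))

  3/2≤½+1+0 : 3/2 ≤ ½ + (1# + 0#)
  3/2≤½+1+0 = begin
    3/2           ≈⟨ 1+½≈3/2 ⟨
    1# + ½        ≈⟨ +-comm 1# ½ ⟩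
    ½ + 1#        ≈⟨ +-congˡ (+-identityʳ 1#) ⟨
    ½ + (1# + 0#) ∎

  -- The algorithm's schedules become variables, so that its decisions can be split on and the
  -- equations matched with `refl`. Jobs of GoS 1 have no case on `m₂`, which leaves three clauses.
  unmigrated⇒3/2≤ : ∀ {r} (σ : Schedule firstJob)
    (α : Schedule inputA) (β : Schedule inputB) (γ : Schedule inputC) →
    σ ≡ tail α → σ ≡ tail β → β ≡ tail γ →
    makespan α ≤ r → makespan β ≤ r → makespan γ ≤ r → 3/2 ≤ r
  unmigrated⇒3/2≤ ((m₁ , _) ∷ []) α@((m₁ , _) ∷ _) _ _ refl _ _ α≤r _ _ =
    ≤-trans 3/2≤1+½+0 (≤-trans (load≤makespan m₁ α) α≤r)
  unmigrated⇒3/2≤ ((m₂ , _) ∷ []) _ β@((m₂ , _) ∷ _) _ _ refl _ _ β≤r _ =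
    ≤-trans 3/2≤1+½+0 (≤-trans (load≤makespan m₂ β) β≤r)
  -- The equation `β ≡ tail γ` keeps the unit job on `m₁`, where the new half of GoS 1 has to join
  -- it.
  unmigrated⇒3/2≤ ((m₂ , _) ∷ []) _ ((m₁ , _) ∷ _) γ@((m₁ , _) ∷ _) _ refl refl _ _ γ≤r =
    ≤-trans 3/2≤½+1+0 (≤-trans (load≤makespan m₁ γ) γ≤r)

mainTheorem16 : {c ℓ₁ ℓ₂ : Level} (F : OrderedField c ℓ₁ ℓ₂) →
    let open OrderedField F
        open BinStretching F
    in (M : Carrier) → 0# ≤ M → M < ½ →
       (A : Algorithm M) → CompetitiveRatioAtLeast A 3/2
mainTheorem16 F M 0≤M M<½ A r bound = unmigrated⇒3/2≤
  (schedule A firstJob) (schedule A inputA) (schedule A inputB) (schedule A inputC)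
  (unmigrated 0≤M M<½ A ≤-refl (≤-refl ∷ []) (input⇒possible isInputA))
  (unmigrated 0≤M M<½ A ≤-refl (≤-refl ∷ []) (input⇒possible isInputB))
  (unmigrated 0≤M M<½ A ½≤1 (½≤1 ∷ ≤-refl ∷ []) (input⇒possible isInputC))
  (bound inputA isInputA) (bound inputB isInputB) (bound inputC isInputC)
  where
  open OrderedField F
  open BinStretching F
  open OrderedFieldProperties F
  open LowerBound F
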